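{- Let $G_n$ denote the number of binary words of length $n$ that are cubefree and contain no square $xx$ with $|x|\ge 4$. Then $G_n=\Omega(1.002^n)$ and $G_n=O(1.178^n)$.
   Context: A square is a nonempty word $xx$ and a cube a nonempty word $xxx$ (as contiguous subwords); cubefree means containing no cube. -}

module Defs where

open import Data.Bool using (Bool)
open import Data.Nat using (ℕ; _≤_; _*_; _^_)
open import Data.List using (List; _++_; length)
open import Data.List.Membership.Propositional using (_∈_)
open import Data.List.Relation.Unary.Unique.Propositional using (Unique)
open import Data.Product using (Σ; ∃; _×_; ∃-syntax)
open import Function.Bundles using (_⇔_)
open import Relation.Binary.PropositionalEquality using (_≡_)
open import Relation.Nullary using (¬_)

Word : Set
Word = List Bool

_isFactorOf_ : Word → Word → Set
f isFactorOf w = ∃[ u ] ∃[ v ] w ≡ u ++ f ++ v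

ContainsCube : Word → Set
ContainsCube w = ∃[ x ] (1 ≤ length x × (x ++ x ++ x) isFactorOf w)

CubeFree : Word → Set
CubeFree w = ¬ ContainsCube w

ContainsLongSquare : Word → Set
ContainsLongSquare w = ∃[ x ] (4 ≤ length x × (x ++ x) isFactorOf w)

Good : Word → Set
Good w = CubeFree w × ¬ ContainsLongSquare w

GCount : ℕ → ℕ → Set
GCount n k = Σ (List Word) λ L →
  Unique L × (∀ w → (w ∈ L) ⇔ (length w ≡ n × Good w)) × length L ≡ k

{-# OPTIONS --safe #-}
module Submission where

open import Defs
open import Data.Bool using (Bool; true; false)
import Data.Bool.Properties as Bool
open import Data.Fin using (Fin)
import Data.Fin.Properties as Fin
open import Data.List using (List; []; _∷_; _++_; _∷ʳ_; length; take; drop; map; filter; concatMap;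
  allFin; upTo; cartesianProduct; cartesianProductWith)
open import Data.List.Properties using (length-++; length-map; length-take; length-drop; ++-assoc;
  take++drop≡id; take-[]; drop-drop; drop-[]; length-removeAt′; ∷-injective)
open import Data.List.Membership.Propositional using (_∈_)
open import Data.List.Membership.Propositional.Properties
  using (∈-filter⁺; ∈-filter⁻; ∈-++⁺ˡ; ∈-++⁺ʳ; ∈-map⁺; ∈-allFin; ∈-cartesianProductWith⁺;
         ∈-cartesianProductWith⁻; ∈-cartesianProduct⁺)
open import Data.List.Relation.Unary.All as All using (All; []; _∷_)
open import Data.List.Relation.Unary.All.Properties using (all-filter)
open import Data.List.Relation.Unary.AllPairs using ([]; _∷_)
open import Data.List.Relation.Unary.Any as Any using (Any; here; there; any?; _─_; index)
open import Data.List.Relation.Unary.Unique.Propositional using (Unique)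
import Data.List.Relation.Unary.Unique.Propositional.Properties as Unique
open import Data.Maybe as Maybe using (Maybe; nothing; from-just)
open import Data.Nat
open import Data.Nat.DivMod using (m≡m%n+[m/n]*n; m%n<n; m/n*n≤m)
open import Data.Nat.ListAction using (sum)
open import Data.Nat.Properties
open import Data.Nat.Tactic.RingSolver using (solve-∀)
open import Data.Product using (_×_; _,_; proj₁; proj₂; ∃-syntax)
open import Data.Sum using (_⊎_; inj₁; inj₂)
open import Data.Unit using (⊤; tt)
open import Function using (_∘_; id)
open import Function.Bundles using (Equivalence)
open import Relation.Binary using (DecidableEquality)
open import Relation.Binary.PropositionalEquality
open import Relation.Nullary using (¬_; Dec; yes; no; does; contradiction)
open import Relation.Nullary.Decidable using (map′; ¬?; _×-dec_; _⊎-dec_; _→-dec_; dec⇒maybe;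
  toWitness; from-yes)
open import Relation.Unary using (Decidable)

-- Upper bound.  The trie below gives every word a weight depending on its first 24 letters.  The
-- weight of a good word w of length at least 24 is positive, and then the weights of 0w and 1w
-- add up to at most 589/500 times the weight of w, so the total weight of the words of length n
-- obtained by prolonging words of positive weight is O((589/500)^n).
--
-- Lower bound.  A 47-uniform morphism sends squarefree words over four letters to good words.
-- All its images start with the marker 10110110, which occurs in the image of a squarefree word
-- only at block boundaries.  A square with a long period contains a marker in its first half, so
-- its period is a multiple of 47 and it projects to a square of letters; short periods are
-- excluded by inspecting the images of squarefree words of length at most 3.  There are at least
-- 2^m squarefree words of length m over four letters, and 501^47 ≤ 2 * 500^47.

-- Repetitions

module _ {A : Set} where

  -- Both lists must really have `n` letters, so a period that overruns the end of a word never
  -- counts as a repetition.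
  data Agree : ℕ → List A → List A → Set where
    []  : ∀ {xs ys} → Agree zero xs ys
    _∷_ : ∀ {n xs ys} x → Agree n xs ys → Agree (suc n) (x ∷ xs) (x ∷ ys)

  -- Records a period at the start of the word and leaves the root unnamed, which suits decision by
  -- computation; other positions are reached with `drop`.
  Square : ℕ → List A → Set
  Square p w = Agree p w (drop p w)

  Cube : ℕ → List A → Set
  Cube p w = Square p w × Square p (drop p w)

  -- The empty square of period 0 occurs everywhere, hence `suc p`.
  SquareFree : List A → Set
  SquareFree w = ∀ i p → ¬ Square (suc p) (drop i w)

  agree-take⁺ : ∀ {n k m xs ys} → n ≤ k → n ≤ m → Agree n xs ys → Agree n (take k xs) (take m ys)
  agree-take⁺ _ _ [] = []
  agree-take⁺ (s≤s h) (s≤s k) (x ∷ a) = x ∷ agree-take⁺ h k a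

  agree-take⁻ : ∀ {n} k m {xs ys} → Agree n (take k xs) (take m ys) → Agree n xs ys
  agree-take⁻ {zero} _ _ _ = []
  agree-take⁻ {suc n} (suc k) (suc m) {_ ∷ _} {_ ∷ _} (x ∷ a) = x ∷ agree-take⁻ k m a

  agree-mono : ∀ {m n xs ys} → m ≤ n → Agree n xs ys → Agree m xs ys
  agree-mono {zero} _ _ = []
  agree-mono {suc m} (s≤s m≤n) (x ∷ a) = x ∷ agree-mono m≤n a

  agree-drop : ∀ {n} m {xs ys} → Agree (m + n) xs ys → Agree n (drop m xs) (drop m ys)
  agree-drop zero a = a
  agree-drop (suc m) (x ∷ a) = agree-drop m a

  agree-trans : ∀ {n xs ys zs} → Agree n xs ys → Agree n ys zs → Agree n xs zs
  agree-trans [] _ = []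
  agree-trans (x ∷ a) (.x ∷ b) = x ∷ agree-trans a b

  agree-refl : ∀ {n xs} → n ≤ length xs → Agree n xs xs
  agree-refl {zero} _ = []
  agree-refl {suc n} {x ∷ xs} (s≤s h) = x ∷ agree-refl h

  agree-++⁻ : ∀ {n} xs ys {us vs} → n ≤ length xs → n ≤ length ys →
              Agree n (xs ++ us) (ys ++ vs) → Agree n xs ys
  agree-++⁻ {zero} _ _ _ _ _ = []
  agree-++⁻ {suc n} (_ ∷ xs) (_ ∷ ys) (s≤s h) (s≤s k) (x ∷ a) = x ∷ agree-++⁻ xs ys h k a

  agree-++⁺ : ∀ x {u v : List A} → Agree (length x) (x ++ u) (x ++ v)
  agree-++⁺ [] = []
  agree-++⁺ (c ∷ x) = c ∷ agree-++⁺ x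

  agree⇒lengthˡ : ∀ {n xs ys} → Agree n xs ys → n ≤ length xs
  agree⇒lengthˡ [] = z≤n
  agree⇒lengthˡ (x ∷ a) = s≤s (agree⇒lengthˡ a)

  agree⇒take≡ : ∀ {n xs ys} → Agree n xs ys → take n xs ≡ take n ys
  agree⇒take≡ [] = refl
  agree⇒take≡ (x ∷ a) = cong (x ∷_) (agree⇒take≡ a)

  agree⇒prefix : ∀ x {u ys} → Agree (length x) (x ++ u) ys → ∃[ v ] ys ≡ x ++ v
  agree⇒prefix [] _ = _ , refl
  agree⇒prefix (c ∷ x) (.c ∷ a) with agree⇒prefix x a
  ... | v , refl = v , refl

  drop-length-++ : ∀ x {u : List A} → drop (length x) (x ++ u) ≡ u
  drop-length-++ [] = refl
  drop-length-++ (_ ∷ x) = drop-length-++ x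

  drop-comm : ∀ m n (xs : List A) → drop m (drop n xs) ≡ drop n (drop m xs)
  drop-comm m n xs = trans (drop-drop n m xs)
    (trans (cong (λ k → drop k xs) (+-comm n m)) (sym (drop-drop m n xs)))

  agree-extend : ∀ {n xs ys} {us : List A} → Agree n xs ys → Agree n xs (ys ++ us)
  agree-extend [] = []
  agree-extend (x ∷ a) = x ∷ agree-extend a

  agree-truncate : ∀ {n m} {xs ys : List A} → n ≤ m → Agree n xs ys → Agree n xs (take m ys)
  agree-truncate _ [] = []
  agree-truncate (s≤s h) (x ∷ a) = x ∷ agree-truncate h a

  drop-++≤ : ∀ n (xs : List A) {ys} → n ≤ length xs → drop n (xs ++ ys) ≡ drop n xs ++ ys
  drop-++≤ zero _ _ = refl
  drop-++≤ (suc n) (_ ∷ xs) (s≤s h) = drop-++≤ n xs h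

  take-length+-++ : ∀ xs n {ys : List A} → take (length xs + n) (xs ++ ys) ≡ xs ++ take n ys
  take-length+-++ [] n = refl
  take-length+-++ (x ∷ xs) n = cong (x ∷_) (take-length+-++ xs n)

  ¬agree-[]ˡ : ∀ {n} {ys : List A} → 0 < n → ¬ Agree n [] ys
  ¬agree-[]ˡ () []

  ¬agree-[]ʳ : ∀ {n} {xs : List A} → 0 < n → ¬ Agree n xs []
  ¬agree-[]ʳ () []

  square⇒xx : ∀ {p w} → Square p w → ∃[ x ] ∃[ v ] length x ≡ p × w ≡ x ++ x ++ v
  square⇒xx {p} {w} s =
    let |x|≡p  = trans (length-take p w) (m≤n⇒m⊓n≡m (agree⇒lengthˡ s))
        v , d≡ = agree⇒prefix (take p w)
                   (subst₂ (λ n z → Agree n z (drop p w)) (sym |x|≡p) (sym (take++drop≡id p w)) s)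
    in take p w , v , |x|≡p , trans (sym (take++drop≡id p w)) (cong (take p w ++_) d≡)

  xx⇒square : ∀ x {v} → Square (length x) (x ++ x ++ v)
  xx⇒square x = subst (Agree (length x) _) (sym (drop-length-++ x)) (agree-++⁺ x)

  cube⇒xxx : ∀ {p w} → Cube p w → ∃[ x ] ∃[ v ] length x ≡ p × w ≡ x ++ x ++ x ++ v
  cube⇒xxx (s , s′) with square⇒xx s
  ... | x , v , refl , refl
    with t ← subst (Square (length x)) (drop-length-++ x) s′
    with v′ , refl ← agree⇒prefix x (subst (Agree (length x) (x ++ v)) (drop-length-++ x) t)
    = x , v′ , refl , refl

  xxx⇒cube : ∀ x {v} → Cube (length x) (x ++ x ++ x ++ v)
  xxx⇒cube x = xx⇒square x , subst (Square (length x)) (sym (drop-length-++ x)) (xx⇒square x)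

  drop-take : ∀ k m (w : List A) → drop k (take m w) ≡ take (m ∸ k) (drop k w)
  drop-take zero m w = refl
  drop-take (suc k) zero w = refl
  drop-take (suc k) (suc m) [] = sym (take-[] (m ∸ k))
  drop-take (suc k) (suc m) (x ∷ w) = drop-take k m w

  square-take⁻ : ∀ {p} m {w} → Square p (take m w) → Square p w
  square-take⁻ {p} m {w} s = agree-take⁻ m (m ∸ p) (subst (Agree p _) (drop-take p m w) s)

  square-take⁺ : ∀ {p m w} → p + p ≤ m → Square p w → Square p (take m w)
  square-take⁺ {p} {m} {w} 2p≤m s = subst (Agree p _) (sym (drop-take p m w))
    (agree-take⁺ (m+n≤o⇒m≤o p 2p≤m) (m+n≤o⇒m≤o∸n p 2p≤m) s)

  squareFree-drop : ∀ {w} m → SquareFree w → SquareFree (drop m w)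
  squareFree-drop {w} m sf i p s = sf (m + i) p (subst (Square (suc p)) (drop-drop m i w) s)

  squareFree-take : ∀ {w} m → SquareFree w → SquareFree (take m w)
  squareFree-take {w} m sf i p s = sf i p
    (square-take⁻ (m ∸ i) (subst (Square (suc p)) (drop-take i m w) s))

module _ {A : Set} (_≟ᴬ_ : DecidableEquality A) where

  agree? : ∀ n (xs ys : List A) → Dec (Agree n xs ys)
  agree? zero _ _ = yes []
  agree? (suc n) [] _ = no λ ()
  agree? (suc n) (_ ∷ _) [] = no λ ()
  agree? (suc n) (x ∷ xs) (y ∷ ys) =
    map′ (λ { (refl , a) → x ∷ a }) (λ { (_ ∷ a) → refl , a }) (x ≟ᴬ y ×-dec agree? n xs ys)

  square? : ∀ p w → Dec (Square p w)
  square? p w = agree? p w (drop p w)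

  cube? : ∀ p w → Dec (Cube p w)
  cube? p w = square? p w ×-dec square? p (drop p w)

-- Counting by injections

module _ {A B : Set} where

  ∈-─⁺ : ∀ {y z : B} {ys} (y∈ys : y ∈ ys) → z ≢ y → z ∈ ys → z ∈ (ys ─ y∈ys)
  ∈-─⁺ (here refl) z≢y (here refl) = contradiction refl z≢y
  ∈-─⁺ (here _) _ (there z∈) = z∈
  ∈-─⁺ (there _) _ (here eq) = here eq
  ∈-─⁺ (there y∈) z≢y (there z∈) = there (∈-─⁺ y∈ z≢y z∈)

  -- Pigeonhole by induction: removing `f x` shortens `ys` by one, and the images of the other
  -- entries differ from `f x`, so they survive the removal.
  injection⇒length≤ : ∀ {xs : List A} {ys : List B} (f : A → B) → Unique xs →
    (∀ {x} → x ∈ xs → f x ∈ ys) →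
    (∀ {x x′} → x ∈ xs → x′ ∈ xs → f x ≡ f x′ → x ≡ x′) →
    length xs ≤ length ys
  injection⇒length≤ {[]} f _ _ _ = z≤n
  injection⇒length≤ {x ∷ xs} {ys} f (x∉xs ∷ u) f∈ inj =
    subst (suc (length xs) ≤_) (sym (length-removeAt′ ys (index (f∈ (here refl)))))
      (s≤s (injection⇒length≤ f u
        (λ x′∈ → ∈-─⁺ (f∈ (here refl))
           (λ eq → All.lookup x∉xs x′∈ (sym (inj (there x′∈) (here refl) eq))) (f∈ (there x′∈)))
        (λ p q → inj (there p) (there q))))

subset⇒length≤ : ∀ {A : Set} {xs ys : List A} → Unique xs →
  (∀ {x} → x ∈ xs → x ∈ ys) → length xs ≤ length ys
subset⇒length≤ u ⊆ = injection⇒length≤ id u ⊆ (λ _ _ → id)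

-- Good words in terms of periods and positions

good-prefix : ∀ u {v} → Good (u ++ v) → Good u
good-prefix u {v} (cf , nls) =
  (λ { (x , h , s , t , refl) → cf (x , h , s , t ++ v , assoc s (x ++ x ++ x) t) }) ,
  (λ { (x , h , s , t , refl) → nls (x , h , s , t ++ v , assoc s (x ++ x) t) })
  where
  assoc : ∀ s f t → (s ++ f ++ t) ++ v ≡ s ++ f ++ t ++ v
  assoc s f t = trans (++-assoc s (f ++ t) v) (cong (s ++_) (++-assoc f t v))

good-suffix : ∀ u {v} → Good (u ++ v) → Good v
good-suffix u (cf , nls) =
  (λ { (x , h , s , t , refl) → cf (x , h , u ++ s , t , sym (++-assoc u s _)) }) ,
  (λ { (x , h , s , t , refl) → nls (x , h , u ++ s , t , sym (++-assoc u s _)) })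

assoc₃ : ∀ (x v : Word) → (x ++ x ++ x) ++ v ≡ x ++ x ++ x ++ v
assoc₃ x v = trans (++-assoc x (x ++ x) v) (cong (x ++_) (++-assoc x x v))

good⇒¬square : ∀ {w p} → Good w → 4 ≤ p → ¬ Square p w
good⇒¬square (_ , nls) 4≤p s with square⇒xx s
... | x , v , refl , refl = nls (x , 4≤p , [] , v , sym (++-assoc x x v))

good⇒¬cube : ∀ {w p} → Good w → 1 ≤ p → ¬ Cube p w
good⇒¬cube (cf , _) 1≤p c with cube⇒xxx c
... | x , v , refl , refl = cf (x , 1≤p , [] , v , sym (assoc₃ x v))

-- A cube of period at least 4 already starts with a long square, so only the cubes of periods 1, 2
-- and 3 remain to be excluded.
good-intro : ∀ {w} → (∀ i {p} → 4 ≤ p → ¬ Square p (drop i w)) →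
             (∀ i {p} → 1 ≤ p → p < 4 → ¬ Cube p (drop i w)) → Good w
good-intro {w} ¬sq ¬cu =
  (λ { (x , h , u , v , w≡) →
       cube x h (length u) (subst (Cube (length x)) (sym (pos u w≡ (assoc₃ x v))) (xxx⇒cube x)) }) ,
  (λ { (x , h , u , v , w≡) →
       ¬sq (length u) h (subst (Square (length x)) (sym (pos u w≡ (++-assoc x x v))) (xx⇒square x)) })
  where
  pos : ∀ u {f g} → w ≡ u ++ f → f ≡ g → drop (length u) w ≡ g
  pos u refl refl = drop-length-++ u
  cube : ∀ x → 1 ≤ length x → ∀ i → ¬ Cube (length x) (drop i w)
  cube x h i c with length x <? 4
  ... | yes l<4 = ¬cu i h l<4 c
  ... | no l≮4 = ¬sq i (≮⇒≥ l≮4) (proj₁ c)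

-- Upper bound: weights on a trie

-- The lower bounds on `p` are part of the test, so soundness in `forbidden⇒¬good` holds for any
-- list `ps`.
Forbidden : List ℕ → Word → Set
Forbidden ps w = Any (λ p → 1 ≤ p × Cube p w) (1 ∷ 2 ∷ 3 ∷ []) ⊎ Any (λ p → 4 ≤ p × Square p w) ps

forbidden? : ∀ ps w → Dec (Forbidden ps w)
forbidden? ps w = any? (λ p → 1 ≤? p ×-dec cube? Bool._≟_ p w) _
            ⊎-dec any? (λ p → 4 ≤? p ×-dec square? Bool._≟_ p w) ps

Contains : List ℕ → Word → Set
Contains ps [] = Forbidden ps []
Contains ps (c ∷ w) = Forbidden ps (c ∷ w) ⊎ Contains ps w

contains? : ∀ ps w → Dec (Contains ps w)
contains? ps [] = forbidden? ps []
contains? ps (c ∷ w) = forbidden? ps (c ∷ w) ⊎-dec contains? ps w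

forbidden⇒¬good : ∀ {ps w} → Forbidden ps w → ¬ Good w
forbidden⇒¬good (inj₁ c) g = let _ , 1≤p , c = Any.satisfied c in good⇒¬cube g 1≤p c
forbidden⇒¬good (inj₂ s) g = let _ , 4≤p , s = Any.satisfied s in good⇒¬square g 4≤p s

contains⇒¬good : ∀ {ps} w → Contains ps w → ¬ Good w
contains⇒¬good [] f g = forbidden⇒¬good f g
contains⇒¬good (c ∷ w) (inj₁ f) g = forbidden⇒¬good f g
contains⇒¬good (c ∷ w) (inj₂ f) g = contains⇒¬good w f (good-suffix (c ∷ []) g)

infix 5 _∣_
data Trie : Set where
  leaf : ℕ → Trie
  _∣_  : Trie → Trie → Trie

-- A leaf is its own child, so tries of different shapes can be descended in step.
child : Bool → Trie → Trie
child _ (leaf n) = leaf n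
child false (l ∣ r) = l
child true  (l ∣ r) = r

depth : Trie → ℕ
depth (leaf _) = 0
depth (l ∣ r) = suc (depth l ⊔ depth r)

-- A word that ends inside the trie is read as if padded by false.
weight : Trie → Word → ℕ
weight (leaf n) _ = n
weight (l ∣ r) [] = weight l []
weight (l ∣ r) (false ∷ w) = weight l w
weight (l ∣ r) (true ∷ w) = weight r w

weight-[] : ∀ t → weight t [] ≡ weight (child false t) []
weight-[] (leaf _) = refl
weight-[] (_ ∣ _) = refl

weight-∷ : ∀ c w t → weight t (c ∷ w) ≡ weight (child c t) w
weight-∷ c w (leaf _) = refl
weight-∷ false w (_ ∣ _) = refl
weight-∷ true w (_ ∣ _) = refl

flip : Trie → Trie
flip (leaf n) = leaf n
flip (l ∣ r) = flip r ∣ flip l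

module _ (a b : ℕ) where

  -- `z` is meant as the weight of a word, `x` and `y` as those of its two prolongations. Weight 0
  -- is exempt because such a word is discarded before it is prolonged.
  Decay : (x y z : ℕ) → Set
  Decay x y z = z ≡ 0 ⊎ b * (x + y) ≤ a * z

  Decaying : (x y z : Trie) → Set
  Decaying x y z = ∀ w → Decay (weight x w) (weight y w) (weight z w)

  decaying-split : ∀ x y z → (∀ c → Decaying (child c x) (child c y) (child c z)) → Decaying x y z
  decaying-split x y z h [] rewrite weight-[] x | weight-[] y | weight-[] z = h false []
  decaying-split x y z h (c ∷ w) rewrite weight-∷ c w x | weight-∷ c w y | weight-∷ c w z = h c w

  -- The first argument is fuel for the simultaneous descent. Only a positive answer is used, so
  -- failure and exhausted fuel both give `nothing`.
  decaying? : ℕ → ∀ x y z → Maybe (Decaying x y z)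
  decaying? _ (leaf x) (leaf y) (leaf z) = dec⇒maybe
    (map′ (λ h _ → h) (λ h → h []) (z ≟ 0 ⊎-dec b * (x + y) ≤? a * z))
  decaying? zero _ _ _ = nothing
  decaying? (suc d) x y z = Maybe.zipWith (λ h k → decaying-split x y z λ { false → h ; true → k })
    (decaying? d (child false x) (child false y) (child false z))
    (decaying? d (child true x) (child true y) (child true z))

module _ (ps : List ℕ) where

  -- `u` is the path from the root. Each zero leaf needs a forbidden factor inside its path as a
  -- certificate that no good word is discarded there.
  ZerosBad : Trie → Word → Set
  ZerosBad (leaf zero) u = Contains ps u
  ZerosBad (leaf (suc _)) _ = ⊤
  ZerosBad (l ∣ r) u = ZerosBad l (u ∷ʳ false) × ZerosBad r (u ∷ʳ true)

  zerosBad? : ∀ t u → Dec (ZerosBad t u)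
  zerosBad? (leaf zero) u = contains? ps u
  zerosBad? (leaf (suc _)) _ = yes tt
  zerosBad? (l ∣ r) u = zerosBad? l (u ∷ʳ false) ×-dec zerosBad? r (u ∷ʳ true)

  -- The length bound makes `w` reach a leaf without padding, so the path to that leaf is a genuine
  -- prefix of the good word.
  good⇒weight≢0 : ∀ t {u} w → ZerosBad t u → depth t ≤ length w → Good (u ++ w) → weight t w ≢ 0
  good⇒weight≢0 (leaf zero) {u} w z _ g _ = contains⇒¬good u z (good-prefix u g)
  good⇒weight≢0 (l ∣ r) {u} (false ∷ w) (z , _) (s≤s d) g =
    good⇒weight≢0 l w z (m⊔n≤o⇒m≤o _ _ d) (subst Good (sym (++-assoc u _ w)) g)
  good⇒weight≢0 (l ∣ r) {u} (true ∷ w) (_ , z) (s≤s d) g =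
    good⇒weight≢0 r w z (m⊔n≤o⇒n≤o _ _ d) (subst Good (sym (++-assoc u _ w)) g)

-- Growth bound from a decaying weight

extensions : List Word → List Word
extensions [] = []
-- New letters go in front, where the trie reads; the two prolongations are adjacent so that
-- `total-extensions` can pair their weights.
extensions (w ∷ ws) = (false ∷ w) ∷ (true ∷ w) ∷ extensions ws

∈-extensions : ∀ c {w ws} → w ∈ ws → c ∷ w ∈ extensions ws
∈-extensions false (here refl) = here refl
∈-extensions true (here refl) = there (here refl)
∈-extensions c (there w∈) = there (there (∈-extensions c w∈))

words : ℕ → List Word
words zero = [] ∷ []
words (suc n) = extensions (words n)

∈-words : ∀ w → w ∈ words (length w)
∈-words [] = here refl
∈-words (c ∷ w) = ∈-extensions c (∈-words w)

module _ (a b : ℕ) (ps : List ℕ) (t : Trie)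
         (decay : Decaying a b (child false t) (child true t) t)
         (zeros : ZerosBad ps t []) where

  private
    live : List Word → List Word
    live = filter (λ w → ¬? (weight t w ≟ 0))

    -- Filtering by weight instead of goodness keeps a list whose total is controlled by the decay
    -- inequality alone.
    survivors : ℕ → List Word
    survivors zero    = live (words (depth t))
    survivors (suc d) = live (extensions (survivors d))

    total : List Word → ℕ
    total = sum ∘ map (weight t)

    total-filter≤ : ∀ {P : Word → Set} (P? : Decidable P) ws → total (filter P? ws) ≤ total ws
    total-filter≤ P? [] = z≤n
    total-filter≤ P? (w ∷ ws) with does (P? w)
    ... | false = m≤n⇒m≤o+n (weight t w) (total-filter≤ P? ws)
    ... | true  = +-monoʳ-≤ (weight t w) (total-filter≤ P? ws)

    -- A nonzero natural number is at least 1, so every word contributes at least 1 to the total.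
    length≤total : ∀ {ws} → All (λ w → weight t w ≢ 0) ws → length ws ≤ total ws
    length≤total [] = z≤n
    length≤total (≢0 ∷ alive) = +-mono-≤ (n≢0⇒n>0 ≢0) (length≤total alive)

    total-extensions : ∀ ws → All (λ w → weight t w ≢ 0) ws → b * total (extensions ws) ≤ a * total ws
    total-extensions [] [] = ≤-trans (≤-reflexive (*-zeroʳ b)) z≤n
    total-extensions (w ∷ ws) (≢0 ∷ alive) with decay w
    ... | inj₁ ≡0 = contradiction ≡0 ≢0
    ... | inj₂ h = begin
      b * (weight t (false ∷ w) + (weight t (true ∷ w) + total (extensions ws)))
        ≡⟨ cong₂ (λ x y → b * (x + (y + total (extensions ws)))) (weight-∷ false w t) (weight-∷ true w t) ⟩
      b * (weight (child false t) w + (weight (child true t) w + total (extensions ws)))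
        ≡⟨ rearrange b (weight (child false t) w) _ _ ⟩
      b * (weight (child false t) w + weight (child true t) w) + b * total (extensions ws)
        ≤⟨ +-mono-≤ h (total-extensions ws alive) ⟩
      a * weight t w + a * total ws
        ≡⟨ *-distribˡ-+ a _ _ ⟨
      a * (weight t w + total ws) ∎
      where
      open ≤-Reasoning
      rearrange : ∀ b x y z → b * (x + (y + z)) ≡ b * (x + y) + b * z
      rearrange = solve-∀

    alive : ∀ d → All (λ w → weight t w ≢ 0) (survivors d)
    alive zero    = all-filter _ (words (depth t))
    alive (suc d) = all-filter _ (extensions (survivors d))

    total-survivors : ∀ d → b ^ d * total (survivors d) ≤ a ^ d * total (survivors 0)
    total-survivors zero = ≤-refl
    total-survivors (suc d) = begin
      b ^ suc d * total (survivors (suc d))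
        ≤⟨ *-monoʳ-≤ (b ^ suc d) (total-filter≤ _ (extensions (survivors d))) ⟩
      b ^ suc d * total (extensions (survivors d))    ≡⟨ swap b (b ^ d) _ ⟩
      b ^ d * (b * total (extensions (survivors d)))
        ≤⟨ *-monoʳ-≤ (b ^ d) (total-extensions _ (alive d)) ⟩
      b ^ d * (a * total (survivors d))               ≡⟨ swap′ a (b ^ d) _ ⟩
      a * (b ^ d * total (survivors d))               ≤⟨ *-monoʳ-≤ a (total-survivors d) ⟩
      a * (a ^ d * total (survivors 0))               ≡⟨ *-assoc a (a ^ d) _ ⟨
      a ^ suc d * total (survivors 0)                 ∎
      where
      open ≤-Reasoning
      swap : ∀ b x y → b * x * y ≡ x * (b * y)
      swap = solve-∀
      swap′ : ∀ a x y → x * (a * y) ≡ a * (x * y)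
      swap′ = solve-∀

    -- All suffixes of a good word are good; building the word leftwards from its last `depth t`
    -- letters therefore passes every filter.
    survives : ∀ d w → length w ≡ d + depth t → Good w → w ∈ survivors d
    survives zero w |w|≡ g = ∈-filter⁺ _ (subst (λ n → w ∈ words n) |w|≡ (∈-words w))
      (good⇒weight≢0 ps t w zeros (≤-reflexive (sym |w|≡)) g)
    survives (suc d) (c ∷ w) |w|≡ g = ∈-filter⁺ _
      (∈-extensions c (survives d w (suc-injective |w|≡) (good-suffix (c ∷ []) g)))
      (good⇒weight≢0 ps t (c ∷ w) zeros (≤-trans (m≤n+m (depth t) (suc d)) (≤-reflexive (sym |w|≡))) g)

    count≤total : ∀ d k → GCount (d + depth t) k → k ≤ total (survivors d)
    count≤total d k (L , unique , complete , refl) = ≤-trans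
      (subset⇒length≤ unique λ {w} w∈ →
        let |w| , g = Equivalence.to (complete w) w∈ in survives d w |w| g)
      (length≤total (alive d))

  potential⇒upper-bound : b ≤ a → ∃[ C ] ∃[ B ] ∃[ N ] (1 ≤ B ×
    (∀ n k → N ≤ n → GCount n k → B * k * b ^ n ≤ C * a ^ n))
  potential⇒upper-bound b≤a = total (survivors 0) , 1 , depth t , ≤-refl , λ n k N≤n count →
    bound (n ∸ depth t) k (sym (m∸n+n≡m N≤n)) count
    where
    open ≤-Reasoning
    bound : ∀ d k {n} → n ≡ d + depth t → GCount n k → 1 * k * b ^ n ≤ total (survivors 0) * a ^ n
    bound d k refl count = begin
      1 * k * b ^ (d + depth t)
        ≡⟨ cong₂ _*_ (*-identityˡ k) (^-distribˡ-+-* b d (depth t)) ⟩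
      k * (b ^ d * b ^ depth t)
        -- No decay is available for the first `depth t` letters; their factor is absorbed by
        -- `b ≤ a`.
        ≤⟨ *-mono-≤ (count≤total d k count) (*-monoʳ-≤ (b ^ d) (^-monoˡ-≤ (depth t) b≤a)) ⟩
      total (survivors d) * (b ^ d * a ^ depth t)           ≡⟨ swap _ (b ^ d) (a ^ depth t) ⟩
      b ^ d * total (survivors d) * a ^ depth t
        ≤⟨ *-monoˡ-≤ (a ^ depth t) (total-survivors d) ⟩
      a ^ d * total (survivors 0) * a ^ depth t             ≡⟨ swap″ (a ^ d) _ (a ^ depth t) ⟩
      total (survivors 0) * (a ^ d * a ^ depth t)
        ≡⟨ cong (total (survivors 0) *_) (^-distribˡ-+-* a d (depth t)) ⟨
      total (survivors 0) * a ^ (d + depth t)               ∎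
      where
      swap : ∀ x y z → x * (y * z) ≡ y * x * z
      swap = solve-∀
      swap″ : ∀ x y z → x * y * z ≡ y * (x * z)
      swap″ = solve-∀

-- The concrete weights

pattern ℓ n = leaf n
pattern ∅ = leaf 0

-- The weights of the words starting with false: a numerical solution of the decay inequalities,
-- scaled and rounded.  The other half of the trie follows by exchanging the letters.
potential₀ : Trie
potential₀ =
  (∅ ∣ (((∅ ∣ (((∅ ∣ ∅) ∣ (((∅ ∣ ∅) ∣ ∅) ∣ ((ℓ 182 ∣ (ℓ 6913 ∣ (((∅ ∣ (((∅ ∣ (ℓ 182 ∣ ℓ 3038)) ∣
  ℓ 5811) ∣ (∅ ∣ ∅))) ∣ ∅) ∣ ∅))) ∣ ∅))) ∣ (((∅ ∣ ∅) ∣ (((∅ ∣ (((∅ ∣ (∅ ∣ (((∅ ∣ ∅) ∣ ∅) ∣ ∅)))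
  ∣ ℓ 8495) ∣ ∅)) ∣ ℓ 12723) ∣ (((∅ ∣ (((∅ ∣ (ℓ 3653 ∣ ℓ 182)) ∣ ℓ 8232) ∣ (∅ ∣ ∅))) ∣ (((∅ ∣
  (((∅ ∣ (∅ ∣ (((∅ ∣ ∅) ∣ (ℓ 6392 ∣ ℓ 182)) ∣ ∅))) ∣ ℓ 8858) ∣ (((∅ ∣ ∅) ∣ (∅ ∣ ∅)) ∣ ∅))) ∣ (∅
  ∣ (∅ ∣ ∅))) ∣ ∅)) ∣ ∅))) ∣ ∅))) ∣ (((∅ ∣ (ℓ 182 ∣ ℓ 8638)) ∣ ∅) ∣ (((∅ ∣ (((∅ ∣ (ℓ 182 ∣ ℓ
  4582)) ∣ ℓ 182) ∣ (∅ ∣ ∅))) ∣ (((∅ ∣ ((ℓ 8339 ∣ ℓ 182) ∣ ℓ 8339)) ∣ (∅ ∣ ∅)) ∣ (((∅ ∣ (((∅ ∣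
  (ℓ 4771 ∣ ℓ 6533)) ∣ (ℓ 8242 ∣ ℓ 182)) ∣ (∅ ∣ ∅))) ∣ ∅) ∣ ∅))) ∣ ∅))) ∣ ((ℓ 182 ∣ (((∅ ∣ ((ℓ
  263 ∣ ℓ 5368) ∣ (((∅ ∣ ∅) ∣ ∅) ∣ ∅))) ∣ ℓ 11926) ∣ (((∅ ∣ (((∅ ∣ (ℓ 8643 ∣ (((∅ ∣ ∅) ∣ (ℓ 6503
  ∣ ℓ 182)) ∣ ∅))) ∣ ℓ 11466) ∣ (∅ ∣ ∅))) ∣ (((∅ ∣ (((∅ ∣ (∅ ∣ (((∅ ∣ ∅) ∣ (ℓ 8023 ∣ ((ℓ 4195 ∣
  (((∅ ∣ ∅) ∣ ℓ 4195) ∣ ∅)) ∣ ∅))) ∣ ∅))) ∣ ℓ 9544) ∣ ℓ 182)) ∣ (∅ ∣ (∅ ∣ ∅))) ∣ ∅)) ∣ ∅))) ∣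
  ∅))) ∣ (((∅ ∣ (((∅ ∣ (∅ ∣ (((∅ ∣ ∅) ∣ ((ℓ 263 ∣ ℓ 6101) ∣ ((ℓ 4863 ∣ (((∅ ∣ (((∅ ∣ (∅ ∣ (((∅ ∣
  ∅) ∣ ℓ 182) ∣ ∅))) ∣ ℓ 3587) ∣ (((∅ ∣ ∅) ∣ (∅ ∣ ∅)) ∣ ∅))) ∣ (∅ ∣ (∅ ∣ ∅))) ∣ ∅)) ∣ ∅))) ∣
  ∅))) ∣ (((∅ ∣ ∅) ∣ ∅) ∣ (((∅ ∣ (((∅ ∣ ((∅ ∣ (((∅ ∣ ∅) ∣ ∅) ∣ (∅ ∣ ∅))) ∣ ℓ 6325)) ∣ ∅) ∣ (∅ ∣
  ∅))) ∣ (ℓ 6145 ∣ (((∅ ∣ (((∅ ∣ (ℓ 6325 ∣ ℓ 8757)) ∣ ℓ 11116) ∣ (∅ ∣ ∅))) ∣ ∅) ∣ ∅))) ∣ ∅))) ∣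
  (((∅ ∣ ∅) ∣ (((∅ ∣ ((ℓ 182 ∣ ℓ 7230) ∣ ∅)) ∣ ℓ 16284) ∣ (((∅ ∣ (((∅ ∣ (ℓ 11752 ∣ (((∅ ∣ ∅) ∣
  (ℓ 8797 ∣ (∅ ∣ ∅))) ∣ ∅))) ∣ ℓ 15649) ∣ (∅ ∣ ∅))) ∣ (((∅ ∣ (((∅ ∣ (∅ ∣ (((∅ ∣ ∅) ∣ (ℓ 10895 ∣
  ℓ 5610)) ∣ ∅))) ∣ ℓ 12995) ∣ (((∅ ∣ ∅) ∣ (∅ ∣ ∅)) ∣ ∅))) ∣ (∅ ∣ (∅ ∣ ∅))) ∣ ∅)) ∣ ∅))) ∣ ∅)))
  ∣ (((∅ ∣ (ℓ 182 ∣ ℓ 7352)) ∣ ∅) ∣ (((∅ ∣ (((∅ ∣ (ℓ 6411 ∣ ℓ 10156)) ∣ (ℓ 6411 ∣ (∅ ∣ ∅))) ∣ (∅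
  ∣ ∅))) ∣ (((∅ ∣ ((ℓ 7251 ∣ ℓ 309) ∣ ℓ 7251)) ∣ (∅ ∣ ∅)) ∣ (((∅ ∣ (((∅ ∣ ((∅ ∣ (((∅ ∣ ∅) ∣ ∅) ∣
  (((∅ ∣ ((∅ ∣ ∅) ∣ (∅ ∣ ∅))) ∣ (ℓ 4215 ∣ (((∅ ∣ (∅ ∣ ℓ 4215)) ∣ ∅) ∣ ∅))) ∣ ∅))) ∣ ℓ 5714)) ∣
  (ℓ 7168 ∣ ℓ 309)) ∣ (∅ ∣ ∅))) ∣ ∅) ∣ ∅))) ∣ ∅))) ∣ (((∅ ∣ (((∅ ∣ ((∅ ∣ (((∅ ∣ ∅) ∣ ∅) ∣ (((∅ ∣
  (((∅ ∣ ∅) ∣ ∅) ∣ (∅ ∣ ∅))) ∣ (ℓ 11214 ∣ (((∅ ∣ ((ℓ 4929 ∣ ℓ 9427) ∣ (∅ ∣ ∅))) ∣ ∅) ∣ ∅))) ∣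
  ∅))) ∣ (((∅ ∣ ∅) ∣ (ℓ 13472 ∣ (((∅ ∣ ((ℓ 182 ∣ ℓ 7641) ∣ (∅ ∣ ∅))) ∣ ℓ 10156) ∣ ∅))) ∣ ∅))) ∣
  (ℓ 14013 ∣ (((∅ ∣ ∅) ∣ (ℓ 6307 ∣ ℓ 309)) ∣ ∅))) ∣ (∅ ∣ ∅))) ∣ (((∅ ∣ (((∅ ∣ (∅ ∣ (((∅ ∣ ∅) ∣
  (((∅ ∣ (∅ ∣ ∅)) ∣ ℓ 9684) ∣ ((ℓ 7676 ∣ ℓ 5606) ∣ ∅))) ∣ ∅))) ∣ ((∅ ∣ ∅) ∣ ((ℓ 9798 ∣ (((∅ ∣ ∅)
  ∣ (∅ ∣ ∅)) ∣ ℓ 9798)) ∣ ∅))) ∣ (((∅ ∣ ∅) ∣ (∅ ∣ ((ℓ 5383 ∣ ℓ 182) ∣ ∅))) ∣ ∅))) ∣ (∅ ∣ ((ℓ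
  10150 ∣ ∅) ∣ ∅))) ∣ (((∅ ∣ (((∅ ∣ ((∅ ∣ (((∅ ∣ ∅) ∣ ∅) ∣ (((∅ ∣ ((∅ ∣ ∅) ∣ (∅ ∣ ∅))) ∣ (ℓ
  10409 ∣ (((∅ ∣ (((∅ ∣ ∅) ∣ ℓ 7510) ∣ (∅ ∣ ∅))) ∣ ∅) ∣ ∅))) ∣ ∅))) ∣ (((∅ ∣ ∅) ∣ (ℓ 9673 ∣ (((∅
  ∣ (∅ ∣ (∅ ∣ ∅))) ∣ ℓ 4293) ∣ ∅))) ∣ ∅))) ∣ (ℓ 14950 ∣ ℓ 9981)) ∣ (∅ ∣ ∅))) ∣ (((∅ ∣ (((∅ ∣ (∅
  ∣ (((∅ ∣ ∅) ∣ (ℓ 6828 ∣ ((ℓ 3570 ∣ ((ℓ 182 ∣ (∅ ∣ (∅ ∣ ∅))) ∣ ∅)) ∣ ∅))) ∣ ∅))) ∣ ℓ 8122) ∣ ℓ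
  182)) ∣ (∅ ∣ (∅ ∣ ∅))) ∣ ∅)) ∣ ∅))) ∣ ∅))

potential : Trie
potential = potential₀ ∣ flip potential₀

-- The periods 4 to 12: a square inside 24 letters has period at most 12.
periods : List ℕ
periods = map (4 +_) (upTo 9)

upper-bound : ∃[ a ] ∃[ b ] ∃[ N ] (1 ≤ b ×
  (∀ n k → N ≤ n → GCount n k → b * k * 500 ^ n ≤ a * 589 ^ n))
upper-bound = potential⇒upper-bound 589 500 periods potential
  -- Fuel 24 suffices because the trie looks at no more than 24 letters.
  (from-just (decaying? 589 500 24 (child false potential) (child true potential) potential))
  (toWitness {a? = zerosBad? periods potential []} tt)
  (≤ᵇ⇒≤ 500 589 tt)

-- Squarefree words over four letters

Letter : Set
Letter = Fin 4

-- A period never exceeds the length of the word, so the bound on `p` loses no square and makes the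
-- predicate decidable.
StartsWithSquare : List Letter → Set
StartsWithSquare w = ∃[ p ] (p < length w × Square (suc p) w)

startsWithSquare? : Decidable StartsWithSquare
startsWithSquare? w = anyUpTo? (λ p → square? Fin._≟_ (suc p) w) (length w)

prolongations : List (List Letter) → List (List Letter)
prolongations = cartesianProductWith _∷_ (allFin 4)

-- When the tail is squarefree, a new first letter can only create a square at the very start.
squareFrees : ℕ → List (List Letter)
squareFrees zero    = [] ∷ []
squareFrees (suc n) = filter (¬? ∘ startsWithSquare?) (prolongations (squareFrees n))

∈-squareFrees⁺ : ∀ {w} → SquareFree w → w ∈ squareFrees (length w)
∈-squareFrees⁺ {[]} _ = here refl
∈-squareFrees⁺ {c ∷ w} sf = ∈-filter⁺ _
  (∈-cartesianProductWith⁺ _∷_ (∈-allFin c) (∈-squareFrees⁺ (sf ∘ suc)))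
  λ { (p , _ , s) → sf 0 p s }

∈-prolongations⁻ : ∀ ws {u} → u ∈ prolongations ws → ∃[ c ] ∃[ w ] (w ∈ ws × u ≡ c ∷ w)
∈-prolongations⁻ ws u∈ =
  let c , w , _ , w∈ , u≡ = ∈-cartesianProductWith⁻ _∷_ (allFin 4) ws u∈ in c , w , w∈ , u≡

∈-squareFrees⁻ : ∀ n {w} → w ∈ squareFrees n → length w ≡ n × SquareFree w
∈-squareFrees⁻ zero (here refl) = refl , λ { zero p () ; (suc i) p () }
∈-squareFrees⁻ (suc n) u∈
  with u∈′ , ¬start ← ∈-filter⁻ (¬? ∘ startsWithSquare?) {xs = prolongations (squareFrees n)} u∈
  with c , w , w∈ , refl ← ∈-prolongations⁻ (squareFrees n) u∈′
  with |w|≡ , sf ← ∈-squareFrees⁻ n w∈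
  = cong suc |w|≡ , λ { zero p s → ¬start (p , agree⇒lengthˡ s , s) ; (suc i) → sf i }

prolongations-unique : ∀ {ws} → Unique ws → Unique (prolongations ws)
prolongations-unique = Unique.cartesianProductWith⁺ _∷_ ∷-injective (Unique.allFin⁺ 4)

squareFrees-unique : ∀ n → Unique (squareFrees n)
squareFrees-unique zero = [] ∷ []
squareFrees-unique (suc n) = Unique.filter⁺ _ (prolongations-unique (squareFrees-unique n))

-- At least 2^n squarefree words of length n

#sf : ℕ → ℕ
#sf n = length (squareFrees n)

#sf≤ : ℕ → ℕ
#sf≤ zero    = #sf 0
#sf≤ (suc n) = #sf (suc n) + #sf≤ n

-- A word of length suc n starting with a square xx is determined by its suffix z after the
-- first x, since x is a prefix of z.
restore : ℕ → List Letter → List Letter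
restore n z = take (suc n ∸ length z) z ++ z

withSquare : ℕ → ℕ → List (List Letter)
withSquare n zero    = map (restore n) (squareFrees 0)
withSquare n (suc i) = map (restore n) (squareFrees (suc i)) ++ withSquare n i

length-withSquare : ∀ n i → length (withSquare n i) ≡ #sf≤ i
length-withSquare n zero = length-map (restore n) (squareFrees 0)
length-withSquare n (suc i) = trans (length-++ (map (restore n) (squareFrees (suc i))))
  (cong₂ _+_ (length-map (restore n) (squareFrees (suc i))) (length-withSquare n i))

∈-withSquare : ∀ n {i z} m → i ≤ m → z ∈ squareFrees i → restore n z ∈ withSquare n m
∈-withSquare n zero z≤n z∈ = ∈-map⁺ (restore n) z∈
∈-withSquare n {i} (suc m) i≤ z∈ with i ≟ suc m
... | yes refl = ∈-++⁺ˡ (∈-map⁺ (restore n) z∈)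
... | no i≢ = ∈-++⁺ʳ _ (∈-withSquare n m (≤-pred (≤∧≢⇒< i≤ i≢)) z∈)

-- If a prolongation starts with a square, what follows the first root is a suffix of the squarefree
-- tail, and `restore` rebuilds the prolongation from it.
prolongations⊆ : ∀ n {u} → u ∈ prolongations (squareFrees n) → u ∈ squareFrees (suc n) ++ withSquare n n
prolongations⊆ n {u} u∈ with startsWithSquare? u
... | no ¬start = ∈-++⁺ˡ (∈-filter⁺ _ u∈ ¬start)
... | yes (p , p< , s)
  with c , w , w∈ , refl ← ∈-prolongations⁻ (squareFrees n) u∈
  with |w|≡ , sf ← ∈-squareFrees⁻ n w∈
  = ∈-++⁺ʳ _ (subst (_∈ withSquare n n) restored
      -- `drop p w` is the prolongation without its first root, of length `suc p`; its length
      -- `n ∸ p` reveals the period.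
      (∈-withSquare n n |z|≤n (∈-squareFrees⁺ (squareFree-drop p sf))))
  where
  |z|≡ : length (drop p w) ≡ n ∸ p
  |z|≡ = trans (length-drop p w) (cong (_∸ p) |w|≡)
  |z|≤n : length (drop p w) ≤ n
  |z|≤n = ≤-trans (≤-reflexive |z|≡) (m∸n≤m n p)
  p≤n : p ≤ n
  p≤n = subst (p ≤_) |w|≡ (≤-pred p<)
  |x|≡ : suc n ∸ length (drop p w) ≡ suc p
  |x|≡ = trans (cong (suc n ∸_) |z|≡) (trans (+-∸-assoc 1 (m∸n≤m n p)) (cong suc (m∸[m∸n]≡n p≤n)))
  restored : restore n (drop p w) ≡ c ∷ w
  restored = trans (cong (λ k → take k (drop p w) ++ drop p w) |x|≡)
    (trans (cong (_++ drop p w) (sym (agree⇒take≡ s))) (take++drop≡id (suc p) (c ∷ w)))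

length-cartesianProductWith : ∀ {A B C : Set} (f : A → B → C) xs ys →
  length (cartesianProductWith f xs ys) ≡ length xs * length ys
length-cartesianProductWith f [] ys = refl
length-cartesianProductWith f (x ∷ xs) ys = trans (length-++ (map (f x) ys))
  (cong₂ _+_ (length-map (f x) ys) (length-cartesianProductWith f xs ys))

-- Each squarefree word has four prolongations, and those that fail to be squarefree are covered by
-- `withSquare n n`.
4*#sf≤ : ∀ n → 4 * #sf n ≤ #sf (suc n) + #sf≤ n
4*#sf≤ n = begin
  4 * #sf n
    ≡⟨ length-cartesianProductWith _∷_ (allFin 4) (squareFrees n) ⟨
  length (prolongations (squareFrees n))
    ≤⟨ subset⇒length≤ (prolongations-unique (squareFrees-unique n)) (prolongations⊆ n) ⟩
  length (squareFrees (suc n) ++ withSquare n n)   ≡⟨ length-++ (squareFrees (suc n)) ⟩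
  #sf (suc n) + length (withSquare n n)            ≡⟨ cong (#sf (suc n) +_) (length-withSquare n n) ⟩
  #sf (suc n) + #sf≤ n                             ∎
  where open ≤-Reasoning

#sf-double : ∀ n → #sf≤ n ≤ 2 * #sf n → 2 * #sf n ≤ #sf (suc n)
#sf-double n h = +-cancelʳ-≤ (2 * #sf n) _ _ (begin
  2 * #sf n + 2 * #sf n    ≡⟨ four (#sf n) ⟩
  4 * #sf n                ≤⟨ 4*#sf≤ n ⟩
  #sf (suc n) + #sf≤ n     ≤⟨ +-monoʳ-≤ (#sf (suc n)) h ⟩
  #sf (suc n) + 2 * #sf n  ∎)
  where
  open ≤-Reasoning
  four : ∀ x → 2 * x + 2 * x ≡ 4 * x
  four = solve-∀

-- A geometric-sum induction interlocked with `#sf-double`: the bound at `n` yields doubling at `n`,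
-- and doubling makes the earlier counts sum to at most the newest one.
#sf≤≤2*#sf : ∀ n → #sf≤ n ≤ 2 * #sf n
#sf≤≤2*#sf zero = s≤s z≤n
#sf≤≤2*#sf (suc n) = begin
  #sf (suc n) + #sf≤ n
    ≤⟨ +-monoʳ-≤ (#sf (suc n)) (≤-trans (#sf≤≤2*#sf n) (#sf-double n (#sf≤≤2*#sf n))) ⟩
  #sf (suc n) + #sf (suc n) ≡⟨ cong (#sf (suc n) +_) (+-identityʳ _) ⟨
  2 * #sf (suc n)           ∎
  where open ≤-Reasoning

2^n≤#sf : ∀ n → 2 ^ n ≤ #sf n
2^n≤#sf zero = s≤s z≤n
2^n≤#sf (suc n) = ≤-trans (*-monoʳ-≤ 2 (2^n≤#sf n)) (#sf-double n (#sf≤≤2*#sf n))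

-- A morphism from squarefree words to good words

-- Two separate words instead of a word and its shift, so that `disagree?` can advance both by one
-- letter at a time.
Disagree : (n p : ℕ) (xs ys : Word) → Set
Disagree n p xs ys = ∀ i → i < n → ¬ Agree p (drop i xs) (drop i ys)

-- `K` is the block length, `m` the length of the marker `P`, and `H` the threshold in a block: the
-- letters up to position `H`, and likewise those from `H` on, will identify the block.
module Coding (h : Letter → Word) (K H m : ℕ) .{{_ : NonZero K}} (P : Word) where

  code : List Letter → Word
  code = concatMap h

  -- At most `K ∸ m` letters are compared, so that a start below `K`, a period below `K + m` and the
  -- compared stretch together fit into three blocks. A disagreement there already refutes the whole
  -- square.
  LocallyClean : List Letter → Set
  LocallyClean w =
    (∀ {p} → p < K + m → 4 ≤ p → Disagree K (p ⊓ (K ∸ m)) (code w) (drop p (code w))) ×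
    (∀ {p} → p < 4 → 1 ≤ p → ∀ {i} → i < K → ¬ Cube p (drop i (code w))) ×
    (∀ {i} → i < K → 1 ≤ i → ¬ Agree m P (drop i (code w)))

  module _
    (6≤K : 6 ≤ K) (H<K : H < K) (1≤m : 1 ≤ m) (m≤K : m ≤ K)
    (length-h : ∀ a → length (h a) ≡ K)
    (prefix-code : ∀ a b → Agree (suc H) (h a) (h b) → a ≡ b)
    (suffix-code : ∀ a b → Agree (K ∸ H) (drop H (h a)) (drop H (h b)) → a ≡ b)
    (marked : ∀ a → Agree m P (h a))
    (windows : ∀ {w} → SquareFree w → length w ≤ 3 → LocallyClean w)
    where

    drop-block : ∀ a w → drop K (code (a ∷ w)) ≡ code w
    drop-block a w = subst (λ k → drop k (h a ++ code w) ≡ code w) (length-h a) (drop-length-++ (h a))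

    take-block : ∀ a w n → take (K + n) (code (a ∷ w)) ≡ h a ++ take n (code w)
    take-block a w n = subst (λ k → take (k + n) (h a ++ code w) ≡ h a ++ take n (code w)) (length-h a)
      (take-length+-++ (h a) n)

    code-drop : ∀ n w → drop (n * K) (code w) ≡ code (drop n w)
    code-drop zero w = refl
    code-drop (suc n) [] = drop-[] (K + n * K)
    code-drop (suc n) (a ∷ w) = trans (sym (drop-drop K (n * K) (code (a ∷ w))))
      (trans (cong (drop (n * K)) (drop-block a w)) (code-drop n w))

    code-take : ∀ n w → take (n * K) (code w) ≡ code (take n w)
    code-take zero w = refl
    code-take (suc n) [] = take-[] (K + n * K)
    code-take (suc n) (a ∷ w) = trans (take-block a w (n * K)) (cong (h a ++_) (code-take n w))

    length-code : ∀ w → length (code w) ≡ length w * K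
    length-code [] = refl
    length-code (a ∷ w) = trans (length-++ (h a)) (cong₂ _+_ (length-h a) (length-code w))

    code-drop₁ : ∀ w → drop K (code w) ≡ code (drop 1 w)
    code-drop₁ w = trans (cong (λ k → drop k (code w)) (sym (+-identityʳ K))) (code-drop 1 w)

    H<length-h : ∀ a → H < length (h a)
    H<length-h a = subst (H <_) (sym (length-h a)) H<K

    -- `prefix-code` reads each letter off the first `suc H` letters of its block, so the last block
    -- may be incomplete.
    agree-code⁻ : ∀ n {v v′} → Agree (n * K + suc H) (code v) (code v′) → Agree (suc n) v v′
    agree-code⁻ n {[]} a = contradiction a (¬agree-[]ˡ (m≤n⇒m≤o+n (n * K) (s≤s z≤n)))
    agree-code⁻ n {_ ∷ _} {[]} a = contradiction a (¬agree-[]ʳ (m≤n⇒m≤o+n (n * K) (s≤s z≤n)))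
    agree-code⁻ n {a ∷ v} {b ∷ v′} ag
      with refl ← prefix-code a b (agree-++⁻ (h a) (h b) (H<length-h a) (H<length-h b)
                                    (agree-mono (m≤n+m (suc H) (n * K)) ag))
      = a ∷ rest n ag
      where
      rest : ∀ n → Agree (n * K + suc H) (code (a ∷ v)) (code (a ∷ v′)) → Agree n v v′
      rest zero _ = []
      rest (suc n) ag = agree-code⁻ n (subst₂ (Agree (n * K + suc H)) (drop-block a v) (drop-block a v′)
        (agree-drop K (subst (λ k → Agree k (code (a ∷ v)) (code (a ∷ v′)))
                             (+-assoc K (n * K) (suc H)) ag)))

    -- The first `K ∸ r` agreeing letters finish the block cut at `r`; the other `j * K + r` start
    -- at a block boundary.
    agree-shift : ∀ j {r w w′} → r < K → Agree (suc j * K) (drop r (code w)) (drop r (code w′)) →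
                  Agree (j * K + r) (code (drop 1 w)) (code (drop 1 w′))
    agree-shift j {r} {w} {w′} r<K ag = subst₂ (Agree (j * K + r)) (shift w) (shift w′)
      (agree-drop (K ∸ r) (subst (λ k → Agree k (drop r (code w)) (drop r (code w′))) split ag))
      where
      r+[K∸r]≡K : r + (K ∸ r) ≡ K
      r+[K∸r]≡K = m+[n∸m]≡n (<⇒≤ r<K)
      split : suc j * K ≡ K ∸ r + (j * K + r)
      split = begin
        K + j * K               ≡⟨ cong (_+ j * K) r+[K∸r]≡K ⟨
        r + (K ∸ r) + j * K     ≡⟨ rotate r (K ∸ r) (j * K) ⟩
        K ∸ r + (j * K + r)     ∎
        where
        open ≡-Reasoning
        rotate : ∀ x y z → x + y + z ≡ y + (z + x)
        rotate = solve-∀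
      shift : ∀ w → drop (K ∸ r) (drop r (code w)) ≡ code (drop 1 w)
      shift w = trans (drop-drop r (K ∸ r) (code w))
        (trans (cong (λ k → drop k (code w)) r+[K∸r]≡K) (code-drop₁ w))

    -- For `r ≤ H` the cut block still shows its last `K ∸ H` letters, which fix its letter by
    -- `suffix-code`; the `j` complete blocks after it are decoded from the left.
    agree-cut⁻ : ∀ j {r w w′} → r ≤ H → Agree (suc j * K) (drop r (code w)) (drop r (code w′)) →
                 Agree (suc j) w w′
    agree-cut⁻ j {r} {w} {w′} r≤H ag = letters w w′ cut ag
      where
      r<K : r < K
      r<K = ≤-<-trans r≤H H<K
      0<K∸H : 0 < K ∸ H
      0<K∸H = m<n⇒0<n∸m H<K
      to-H : ∀ w → drop (H ∸ r) (drop r (code w)) ≡ drop H (code w)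
      to-H w = trans (drop-drop r (H ∸ r) (code w)) (cong (λ k → drop k (code w)) (m+[n∸m]≡n r≤H))
      short : H ∸ r + (K ∸ H) ≤ suc j * K
      short = begin
        H ∸ r + (K ∸ H)  ≤⟨ +-monoˡ-≤ (K ∸ H) (m∸n≤m H r) ⟩
        H + (K ∸ H)      ≡⟨ m+[n∸m]≡n (<⇒≤ H<K) ⟩
        K                ≤⟨ m≤m+n K (j * K) ⟩
        suc j * K        ∎
        where open ≤-Reasoning
      cut : Agree (K ∸ H) (drop H (code w)) (drop H (code w′))
      cut = subst₂ (Agree (K ∸ H)) (to-H w) (to-H w′) (agree-drop (H ∸ r) (agree-mono short ag))
      K∸H≤ : ∀ a → K ∸ H ≤ length (drop H (h a))
      K∸H≤ a = ≤-reflexive (sym (trans (length-drop H (h a)) (cong (_∸ H) (length-h a))))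
      rest : ∀ j {v v′} → Agree (j * K + r) (code v) (code v′) → Agree j v v′
      rest zero _ = []
      rest (suc j) ag = agree-code⁻ j (agree-mono (≤-trans (+-monoʳ-≤ (j * K) H<K)
        (≤-trans (≤-reflexive (+-comm (j * K) K)) (m≤m+n (K + j * K) r))) ag)
      letters : ∀ w w′ → Agree (K ∸ H) (drop H (code w)) (drop H (code w′)) →
                Agree (suc j * K) (drop r (code w)) (drop r (code w′)) → Agree (suc j) w w′
      letters [] w′ hd _ = contradiction
        (subst (λ z → Agree (K ∸ H) z (drop H (code w′))) (drop-[] H) hd) (¬agree-[]ˡ 0<K∸H)
      letters (_ ∷ _) [] hd _ = contradiction
        (subst (Agree (K ∸ H) _) (drop-[] H) hd) (¬agree-[]ʳ 0<K∸H)
      letters (a ∷ v) (b ∷ v′) hd ag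
        with refl ← suffix-code a b (agree-++⁻ (drop H (h a)) (drop H (h b)) (K∸H≤ a) (K∸H≤ b)
                      (subst₂ (Agree (K ∸ H))
                        (drop-++≤ H (h a) (<⇒≤ (H<length-h a))) (drop-++≤ H (h b) (<⇒≤ (H<length-h b))) hd))
        = a ∷ rest j (agree-shift j {w = a ∷ v} {w′ = a ∷ v′} r<K ag)

    -- The block cut by the start of the square determines its letter when r ≤ H,
    -- the block cut by its centre does when r > H.
    no-block-square : ∀ {w r} j → SquareFree w → r < K → ¬ Square (suc j * K) (drop r (code w))
    no-block-square {w} {r} j sf r<K s = cut (r ≤? H)
      where
      same : Agree (suc j * K) (drop r (code w)) (drop r (code (drop (suc j) w)))
      same = subst (Agree (suc j * K) (drop r (code w)))
        (trans (drop-comm (suc j * K) r (code w)) (cong (drop r) (code-drop (suc j) w))) s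
      cut : ¬ Dec (r ≤ H)
      cut (yes r≤H) = sf 0 j (agree-cut⁻ j {r} {w} {drop (suc j) w} r≤H same)
      cut (no r≰H)  = sf 1 j (subst (Agree (suc j) (drop 1 w)) (drop-comm 1 (suc j) w)
        (agree-code⁻ j (agree-mono (+-monoʳ-≤ (j * K) (≰⇒> r≰H))
          (agree-shift j {w = w} {w′ = drop (suc j) w} r<K same))))

    window : ∀ i w → drop i (code (take 3 w)) ≡ take (3 * K ∸ i) (drop i (code w))
    window i w = trans (cong (drop i) (sym (code-take 3 w))) (drop-take i (3 * K) (code w))

    clean-window : ∀ {w} → SquareFree w → LocallyClean (take 3 w)
    clean-window {w} sf = windows (squareFree-take 3 sf)
      (≤-trans (≤-reflexive (length-take 3 w)) (m⊓n≤m 3 (length w)))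

    3K≡ : K + K + K ≡ 3 * K
    3K≡ = trans (+-assoc K K K) (cong (λ k → K + (K + k)) (sym (+-identityʳ K)))

    no-short-square : ∀ {w r p} → SquareFree w → r < K → p < K + m → 4 ≤ p →
                      ¬ Square p (drop r (code w))
    no-short-square {w} {r} {p} sf r<K p<K+m 4≤p s =
      proj₁ (clean-window {w} sf) p<K+m 4≤p r r<K
        (subst₂ (Agree (p ⊓ (K ∸ m))) (sym (window r w)) shifted
        (agree-take⁺ (m+n≤o⇒m≤o _ fits) (m+n≤o⇒m≤o∸n _ fits) (agree-mono (m⊓n≤m p (K ∸ m)) s)))
      where
      shifted : take (3 * K ∸ r ∸ p) (drop p (drop r (code w))) ≡ drop r (drop p (code (take 3 w)))
      shifted = trans (sym (drop-take p (3 * K ∸ r) (drop r (code w))))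
        (trans (cong (drop p) (sym (window r w))) (drop-comm p r (code (take 3 w))))
      fits : p ⊓ (K ∸ m) + p ≤ 3 * K ∸ r
      fits = m+n≤o⇒m≤o∸n _ (begin
        p ⊓ (K ∸ m) + p + r    ≤⟨ +-mono-≤ (+-mono-≤ (m⊓n≤n p (K ∸ m)) (<⇒≤ p<K+m)) (<⇒≤ r<K) ⟩
        K ∸ m + (K + m) + K
          ≡⟨ cong (_+ K) (trans (cong (K ∸ m +_) (+-comm K m)) (sym (+-assoc (K ∸ m) m K))) ⟩
        K ∸ m + m + K + K      ≡⟨ cong (λ k → k + K + K) (m∸n+n≡m m≤K) ⟩
        K + K + K              ≡⟨ 3K≡ ⟩
        3 * K                  ∎)
        where open ≤-Reasoning

    -- Here `3 * p` is at most 9 and `6 ≤ K`, so a cube starting in the first block ends within the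
    -- three-block window.
    no-short-cube : ∀ {w r p} → SquareFree w → r < K → p < 4 → 1 ≤ p →
                    ¬ Cube p (drop r (code w))
    no-short-cube {w} {r} {p} sf r<K p<4 1≤p (s , s′) =
      proj₁ (proj₂ (clean-window {w} sf)) p<4 1≤p r<K
        (subst (Cube p) (sym (window r w)) (square-take⁺ (≤-trans fits (m∸n≤m _ p)) s ,
          subst (Square p) (sym (drop-take p (3 * K ∸ r) (drop r (code w)))) (square-take⁺ fits s′)))
      where
      p≤3 : p ≤ 3
      p≤3 = ≤-pred p<4
      2p≤K : p + p ≤ K
      2p≤K = ≤-trans (+-mono-≤ p≤3 p≤3) 6≤K
      fits : p + p ≤ 3 * K ∸ r ∸ p
      fits = m+n≤o⇒m≤o∸n (p + p) (m+n≤o⇒m≤o∸n (p + p + p) (begin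
        p + p + p + r  ≤⟨ +-mono-≤ (+-mono-≤ 2p≤K (m+n≤o⇒m≤o p 2p≤K)) (<⇒≤ r<K) ⟩
        K + K + K      ≡⟨ 3K≡ ⟩
        3 * K          ∎))
        where open ≤-Reasoning

    split-position : ∀ i w → drop i (code w) ≡ drop (i % K) (code (drop (i / K) w))
    split-position i w = begin
      drop i (code w)
        ≡⟨ cong (λ k → drop k (code w)) (trans (m≡m%n+[m/n]*n i K) (+-comm (i % K) _)) ⟩
      drop (i / K * K + i % K) (code w)           ≡⟨ drop-drop (i / K * K) (i % K) (code w) ⟨
      drop (i % K) (drop (i / K * K) (code w))    ≡⟨ cong (drop (i % K)) (code-drop (i / K) w) ⟩
      drop (i % K) (code (drop (i / K) w))        ∎
      where open ≡-Reasoning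

    -- At any other offset the marker would lie strictly inside a block start of the three-block
    -- window beginning at letter `i / K`, which the finite check rules out.
    marker-sync : ∀ {w i} → SquareFree w → Agree m P (drop i (code w)) → i ≡ i / K * K
    marker-sync {w} {i} sf ag with i % K ≟ 0
    ... | yes ≡0 = trans (m≡m%n+[m/n]*n i K) (cong (_+ i / K * K) ≡0)
    ... | no ≢0 = contradiction
      (subst (Agree m P) (sym (window (i % K) (drop (i / K) w)))
        (agree-truncate fits (subst (Agree m P) (split-position i w) ag)))
      (proj₂ (proj₂ (clean-window {drop (i / K) w} (squareFree-drop (i / K) sf)))
        (m%n<n i K) (n≢0⇒n>0 ≢0))
      where
      fits : m ≤ 3 * K ∸ i % K
      fits = m+n≤o⇒m≤o∸n m (≤-trans (+-mono-≤ m≤K (<⇒≤ (m%n<n i K))) (+-monoʳ-≤ K (m≤m+n K _)))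

    -- A block boundary comes at most `K` letters after the start, so the first root contains the
    -- marker found there. Its copy one period later must again sit at a boundary, whence `K`
    -- divides `p`.
    no-long-square : ∀ {w r p} → SquareFree w → r < K → K + m ≤ p → ¬ Square p (drop r (code w))
    no-long-square {w} {r} {p} sf r<K K+m≤p s =
      go (p / K) (marker-sync (squareFree-drop 1 sf) (start (drop 1 w) marker))
      where
      to-block : ∀ xs → drop (K ∸ r) (drop r xs) ≡ drop K xs
      to-block xs = trans (drop-drop r (K ∸ r) xs) (cong (λ k → drop k xs) (m+[n∸m]≡n (<⇒≤ r<K)))
      marker : Agree m (code (drop 1 w)) (drop p (code (drop 1 w)))
      marker = subst₂ (Agree m) (trans (to-block (code w)) (code-drop₁ w))
        (trans (drop-comm (K ∸ r) p (drop r (code w)))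
               (cong (drop p) (trans (to-block (code w)) (code-drop₁ w))))
        (agree-drop (K ∸ r) (agree-mono (≤-trans (+-monoˡ-≤ m (m∸n≤m K r)) K+m≤p) s))
      start : ∀ v {ys} → Agree m (code v) ys → Agree m P ys
      start [] ag = contradiction ag (¬agree-[]ˡ 1≤m)
      start (a ∷ v) ag = agree-trans (agree-extend (marked a)) ag
      go : ∀ q → p ≢ q * K
      go zero refl = contradiction (≤-trans 6≤K (m+n≤o⇒m≤o K K+m≤p)) λ ()
      go (suc j) refl = no-block-square j sf r<K s

    code-good : ∀ {w} → SquareFree w → Good (code w)
    code-good {w} sf = good-intro
      (λ i 4≤p s → no-square i 4≤p (subst (Square _) (split-position i w) s))
      (λ i 1≤p p<4 c → no-short-cube {drop (i / K) w} (sf′ i) (m%n<n i K) p<4 1≤p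
                         (subst (Cube _) (split-position i w) c))
      where
      sf′ : ∀ i → SquareFree (drop (i / K) w)
      sf′ i = squareFree-drop (i / K) sf
      no-square : ∀ i {p} → 4 ≤ p → ¬ Square p (drop (i % K) (code (drop (i / K) w)))
      no-square i {p} 4≤p s with p <? K + m
      ... | yes p<K+m = no-short-square {drop (i / K) w} (sf′ i) (m%n<n i K) p<K+m 4≤p s
      ... | no p≮K+m = no-long-square {drop (i / K) w} (sf′ i) (m%n<n i K) (≮⇒≥ p≮K+m) s

    n≤[1+n/K]*K : ∀ n → n ≤ suc (n / K) * K
    n≤[1+n/K]*K n = begin
      n                ≡⟨ m≡m%n+[m/n]*n n K ⟩
      n % K + n / K * K ≤⟨ +-monoˡ-≤ (n / K * K) (<⇒≤ (m%n<n n K)) ⟩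
      suc (n / K) * K  ∎
      where open ≤-Reasoning

    -- The first `n` letters of the image contain `q` complete blocks and so determine all letters
    -- but the last. Recording that one separately makes `cut` injective, at the price of a factor
    -- 4.
    count-lower : ∀ n k → GCount n k → 2 ^ suc (n / K) ≤ k * 4
    count-lower n k (L , _ , complete , refl) = begin
      2 ^ suc q                                     ≤⟨ 2^n≤#sf (suc q) ⟩
      #sf (suc q)
        ≤⟨ injection⇒length≤ cut (squareFrees-unique (suc q)) cut∈ cut-injective ⟩
      length (cartesianProduct L (squareFrees 1))
        ≡⟨ length-cartesianProductWith _,_ L (squareFrees 1) ⟩
      length L * 4                                  ∎
      where
      open ≤-Reasoning
      q = n / K
      q*K≤n : q * K ≤ n
      q*K≤n = m/n*n≤m n K
      long : ∀ {w} → w ∈ squareFrees (suc q) → suc q * K ≤ length (code w)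
      long {w} w∈ = ≤-reflexive (sym (trans (length-code w)
        (cong (_* K) (proj₁ (∈-squareFrees⁻ (suc q) w∈)))))
      cut : List Letter → Word × List Letter
      cut w = take n (code w) , drop q w
      cut∈ : ∀ {w} → w ∈ squareFrees (suc q) → cut w ∈ cartesianProduct L (squareFrees 1)
      cut∈ {w} w∈ = let |w|≡ , sf = ∈-squareFrees⁻ (suc q) w∈ in ∈-cartesianProduct⁺
        (Equivalence.from (complete _) (
          trans (length-take n (code w))
            (m≤n⇒m⊓n≡m (≤-trans (n≤[1+n/K]*K n) (long w∈))) ,
          good-prefix (take n (code w)) (subst Good (sym (take++drop≡id n (code w))) (code-good sf))))
        (subst (λ k → drop q w ∈ squareFrees k)
          (trans (length-drop q w) (trans (cong (_∸ q) |w|≡) (m+n∸n≡m 1 q)))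
          (∈-squareFrees⁺ (squareFree-drop q sf)))
      letters : ∀ j {w w′} → Agree (j * K) (code w) (code w′) → take j w ≡ take j w′
      letters zero _ = refl
      letters (suc j) ag = agree⇒take≡ (agree-code⁻ j (agree-mono
        (≤-trans (+-monoʳ-≤ (j * K) H<K) (≤-reflexive (+-comm (j * K) K))) ag))
      cut-injective : ∀ {w w′} → w ∈ squareFrees (suc q) → w′ ∈ squareFrees (suc q) →
                      cut w ≡ cut w′ → w ≡ w′
      cut-injective {w} {w′} w∈ _ eq = trans (sym (take++drop≡id q w)) (trans
        (cong₂ _++_ (letters q (agree-take⁻ n n (subst (Agree (q * K) _) (cong proj₁ eq) (agree-refl q*K≤))))
                    (cong proj₂ eq))
        (take++drop≡id q w′))
        where
        q*K≤ : q * K ≤ length (take n (code w))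
        q*K≤ = ≤-trans (⊓-glb q*K≤n (≤-trans (m≤n+m (q * K) K) (long w∈)))
                       (≤-reflexive (sym (length-take n (code w))))

    code⇒lower-bound : ∀ a b .{{_ : NonZero a}} .{{_ : NonZero b}} → a ^ K ≤ 2 * b ^ K →
      ∃[ c ] ∃[ d ] ∃[ N ] (1 ≤ c × 1 ≤ d ×
        (∀ n k → N ≤ n → GCount n k → c * a ^ n ≤ d * k * b ^ n))
    code⇒lower-bound a b a^K≤ = 
      -- `a ^ K` pays for rounding `n` up to a multiple of `K`, and 4 for the letter recorded
      -- separately in `count-lower`.
      1 , a ^ K * 4 , 0 , ≤-refl , ≤-trans (m^n>0 a K) (m≤m*n (a ^ K) 4) , λ n k _ → bound n k
      where
      open ≤-Reasoning
      swap : ∀ x y z → 2 * x * (y * z) ≡ 2 * y * (x * z)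
      swap = solve-∀
      regroup : ∀ x y z → x * (y * 4 * z) ≡ x * 4 * y * z
      regroup = solve-∀
      a^K^≤ : ∀ q → (a ^ K) ^ q ≤ 2 ^ q * (b ^ K) ^ q
      a^K^≤ zero = ≤-refl
      a^K^≤ (suc q) = ≤-trans (*-mono-≤ a^K≤ (a^K^≤ q)) (≤-reflexive (swap (b ^ K) (2 ^ q) ((b ^ K) ^ q)))
      bound : ∀ n k → GCount n k → 1 * a ^ n ≤ a ^ K * 4 * k * b ^ n
      bound n k count = begin
        1 * a ^ n                               ≡⟨ *-identityˡ (a ^ n) ⟩
        a ^ n                                   ≤⟨ ^-monoʳ-≤ a (n≤[1+n/K]*K n) ⟩
        a ^ (K + n / K * K)                     ≡⟨ ^-distribˡ-+-* a K (n / K * K) ⟩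
        a ^ K * a ^ (n / K * K)                 ≡⟨ cong (a ^ K *_) (pow a) ⟩
        a ^ K * (a ^ K) ^ (n / K)               ≤⟨ *-monoʳ-≤ (a ^ K) (a^K^≤ (n / K)) ⟩
        a ^ K * (2 ^ (n / K) * (b ^ K) ^ (n / K)) ≡⟨ cong (λ z → a ^ K * (2 ^ (n / K) * z)) (pow b) ⟨
        a ^ K * (2 ^ (n / K) * b ^ (n / K * K))
          ≤⟨ *-monoʳ-≤ (a ^ K) (*-mono-≤ 2^q≤ (^-monoʳ-≤ b (m/n*n≤m n K))) ⟩
        a ^ K * (k * 4 * b ^ n)                 ≡⟨ regroup (a ^ K) k (b ^ n) ⟩
        a ^ K * 4 * k * b ^ n                   ∎
        where
        pow : ∀ a → a ^ (n / K * K) ≡ (a ^ K) ^ (n / K)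
        pow a = trans (cong (a ^_) (*-comm (n / K) K)) (sym (^-*-assoc a K (n / K)))
        2^q≤ : 2 ^ (n / K) ≤ k * 4
        2^q≤ = ≤-trans (m≤m+n (2 ^ (n / K)) _) (count-lower n k count)

-- The 47-uniform morphism and its finite checks

private
  I = true
  O = false

image : Letter → Word
image Fin.zero =
  I ∷ O ∷ I ∷ I ∷ O ∷ I ∷ I ∷ O ∷ O ∷ I ∷ O ∷ O ∷ I ∷ O ∷ I ∷ I ∷ O ∷ I ∷ O ∷ O ∷ I ∷ O ∷ O ∷ I ∷
  I ∷ O ∷ I ∷ I ∷ O ∷ I ∷ O ∷ O ∷ I ∷ O ∷ I ∷ I ∷ O ∷ O ∷ I ∷ O ∷ O ∷ I ∷ I ∷ O ∷ I ∷ O ∷ O ∷ []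
image (Fin.suc Fin.zero) =
  I ∷ O ∷ I ∷ I ∷ O ∷ I ∷ I ∷ O ∷ O ∷ I ∷ O ∷ O ∷ I ∷ O ∷ I ∷ I ∷ O ∷ I ∷ O ∷ O ∷ I ∷ I ∷ O ∷ I ∷
  I ∷ O ∷ O ∷ I ∷ O ∷ I ∷ I ∷ O ∷ I ∷ O ∷ O ∷ I ∷ O ∷ O ∷ I ∷ I ∷ O ∷ I ∷ I ∷ O ∷ I ∷ O ∷ O ∷ []
image (Fin.suc (Fin.suc Fin.zero)) =
  I ∷ O ∷ I ∷ I ∷ O ∷ I ∷ I ∷ O ∷ O ∷ I ∷ O ∷ O ∷ I ∷ I ∷ O ∷ I ∷ I ∷ O ∷ I ∷ O ∷ O ∷ I ∷ O ∷ O ∷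
  I ∷ I ∷ O ∷ I ∷ O ∷ I ∷ I ∷ O ∷ O ∷ I ∷ O ∷ I ∷ O ∷ O ∷ I ∷ I ∷ O ∷ I ∷ I ∷ O ∷ I ∷ O ∷ O ∷ []
image (Fin.suc (Fin.suc (Fin.suc Fin.zero))) =
  I ∷ O ∷ I ∷ I ∷ O ∷ I ∷ I ∷ O ∷ O ∷ I ∷ O ∷ I ∷ O ∷ O ∷ I ∷ I ∷ O ∷ I ∷ O ∷ I ∷ I ∷ O ∷ O ∷ I ∷
  O ∷ O ∷ I ∷ I ∷ O ∷ I ∷ I ∷ O ∷ O ∷ I ∷ O ∷ I ∷ O ∷ O ∷ I ∷ I ∷ O ∷ I ∷ I ∷ O ∷ I ∷ O ∷ O ∷ []

marker : Word
marker = take 8 (image Fin.zero)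

-- With `H` equal to 23, the first 24 and the last 24 letters of a block each identify it; the two
-- halves share the middle letter.
open Coding image 47 23 8 marker

disagree? : ∀ n p xs ys → Dec (Disagree n p xs ys)
disagree? zero p xs ys = yes λ _ ()
disagree? (suc n) p xs ys = map′
  (λ { (¬a , f) zero _ → ¬a
     ; (¬a , f) (suc i) (s≤s i<n) →
         subst₂ (λ us vs → ¬ Agree p us vs) (drop-drop 1 i xs) (drop-drop 1 i ys) (f i i<n) })
  (λ f → f 0 z<s ,
         λ i i<n → subst₂ (λ us vs → ¬ Agree p us vs)
                     (sym (drop-drop 1 i xs)) (sym (drop-drop 1 i ys)) (f (suc i) (s≤s i<n)))
  (¬? (agree? Bool._≟_ p xs ys) ×-dec disagree? n p (drop 1 xs) (drop 1 ys))

locallyClean? : ∀ w → Dec (LocallyClean w)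
locallyClean? w =
  -- Here 39 is `K ∸ m` and the bound 55 is `K + m`.
  allUpTo? (λ p → 4 ≤? p →-dec disagree? 47 (p ⊓ 39) (code w) (drop p (code w))) 55
  ×-dec allUpTo? (λ p → 1 ≤? p →-dec allUpTo? (λ i → ¬? (cube? Bool._≟_ p (drop i (code w)))) 47) 4
  ×-dec allUpTo? (λ i → 1 ≤? i →-dec ¬? (agree? Bool._≟_ 8 marker (drop i (code w)))) 47

-- A finite check by enumeration. Lengths below 3 are included because fewer than three blocks
-- remain near the end of a word.
windows : ∀ {w} → SquareFree w → length w ≤ 3 → LocallyClean w
windows {w} sf |w|≤3 = All.lookup
  (toWitness {a? = allUpTo? (λ n → All.all? locallyClean? (squareFrees n)) 4} _ (s≤s |w|≤3))
  (∈-squareFrees⁺ sf)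

prefixCode : ∀ a b → Agree 24 (image a) (image b) → a ≡ b
prefixCode = toWitness {a? = Fin.all? λ a → Fin.all? λ b →
  agree? Bool._≟_ 24 (image a) (image b) →-dec a Fin.≟ b} _

suffixCode : ∀ a b → Agree 24 (drop 23 (image a)) (drop 23 (image b)) → a ≡ b
suffixCode = toWitness {a? = Fin.all? λ a → Fin.all? λ b →
  agree? Bool._≟_ 24 (drop 23 (image a)) (drop 23 (image b)) →-dec a Fin.≟ b} _

lower-bound : ∃[ a ] ∃[ b ] ∃[ N ] (1 ≤ a × 1 ≤ b ×
  (∀ n k → N ≤ n → GCount n k → a * 501 ^ n ≤ b * k * 500 ^ n))
lower-bound = code⇒lower-bound (from-yes (6 ≤? 47)) (from-yes (23 <? 47)) (s≤s z≤n) (from-yes (8 ≤? 47))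
  (toWitness {a? = Fin.all? λ a → length (image a) ≟ 47} _)
  prefixCode suffixCode
  (toWitness {a? = Fin.all? λ a → agree? Bool._≟_ 8 marker (image a)} _)
  windows 501 500 (from-yes (501 ^ 47 ≤? 2 * 500 ^ 47))

-- The bases are 501/500 = 1.002 and 589/500 = 1.178 with denominators cleared; in both bounds the
-- implied constant is the fraction `a` over `b`.
theorem8 : (∃[ a ] ∃[ b ] ∃[ N ] (1 ≤ a × 1 ≤ b ×
    (∀ n k → N ≤ n → GCount n k → a * 501 ^ n ≤ b * k * 500 ^ n)))
    ×
    (∃[ a ] ∃[ b ] ∃[ N ] (1 ≤ b ×
    (∀ n k → N ≤ n → GCount n k → b * k * 500 ^ n ≤ a * 589 ^ n)))
theorem8 = lower-bound , upper-bound
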